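{- For any diagram $D$ with $|G(D)|=0$, the ghost Kohnert poset $\mathcal{P}_G(D)$ is a join-semilattice, i.e. every pair of elements has a least upper bound.
   Context: A diagram is a finite set of cells placed at positions $(r,c)\in\mathbb{Z}_{>0}\times\mathbb{Z}_{>0}$ ($r$ the row, counted from the bottom; $c$ the column), each position holding at most one cell; each cell is either an ordinary cell, written $(r,c)$, or a ghost cell, written $\langle r,c\rangle$. A position is empty if it holds no cell of either kind. $G(D)$ denotes the set of ghost cells of $D$. The ghost move at row $r$ of $D$, with result denoted $\mathcal{G}(D,r)$, is defined as follows: if row $r$ is empty, $\mathcal{G}(D,r)=D$. Otherwise let $c$ be the largest column of a cell in row $r$. If this rightmost cell is a ghost cell, or there is no empty position $(\hat r,c)$ with $\hat r<r$, or, letting $\hat r<r$ be maximal with $(\hat r,c)$ empty, there is a ghost cell $\langle r^*,c\rangle$ with $\hat r<r^*<r$, then $\mathcal{G}(D,r)=D$. Otherwise, with $\hat r<r$ maximal such that $(\hat r,c)$ is empty, $\mathcal{G}(D,r)=(D\setminus\{(r,c)\})\cup\{(\hat r,c),\langle r,c\rangle\}$. $\mathrm{GKD}(D)$ is the set of all diagrams obtainable from $D$ by finite (possibly empty) sequences of ghost moves. The ghost Kohnert poset $\mathcal{P}_G(D)$ has underlying set $\mathrm{GKD}(D)$, with $D_2\preceq D_1$ iff $D_2$ can be obtained from $D_1$ by a finite (possibly empty) sequence of ghost moves. -}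

module Defs where

open import Data.Nat using (ℕ; _≤_; _<_)
open import Data.Sum using (_⊎_)
open import Data.Product using (Σ; ∃; _×_; _,_)
open import Relation.Binary.PropositionalEquality using (_≡_; _≢_)
open import Relation.Nullary using (¬_)

data Cell : Set where
  empty ordinary ghost : Cell

-- Positions are indexed by ℕ × ℕ; index (r , c) stands for the paper's
-- position (r+1 , c+1) (row r+1 counted from the bottom, column c+1).
-- A diagram assigns to every position its content, and is finite:
-- all positions outside a bounded box are empty.
record Diagram : Set where
  field
    cell   : ℕ → ℕ → Cell
    finite : ∃ λ B → ∀ r c → (B ≤ r ⊎ B ≤ c) → cell r c ≡ empty
open Diagram public

_≈_ : Diagram → Diagram → Set
D ≈ E = ∀ r c → cell D r c ≡ cell E r c

NoGhosts : Diagram → Set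
NoGhosts D = ∀ r c → cell D r c ≢ ghost

-- Effective ghost move at row r:  E = G(D, r)  in the case where G(D,r) ≠ D.
-- c is the largest column of a cell in row r, that cell is ordinary,
-- rh < r is maximal with (rh , c) empty, there is no ghost ⟨r*, c⟩ with
-- rh < r* < r, and E = (D ∖ {(r,c)}) ∪ {(rh,c), ⟨r,c⟩}.
record GhostStep (D : Diagram) (r : ℕ) (E : Diagram) : Set where
  field
    c          : ℕ
    rh         : ℕ
    rightmost  : cell D r c ≡ ordinary
    nothingRight : ∀ c' → c < c' → cell D r c' ≡ empty
    rh<r       : rh < r
    rhEmpty    : cell D rh c ≡ empty
    rhMaximal  : ∀ r' → rh < r' → r' < r → cell D r' c ≢ empty
    noGhostBetween : ∀ r' → rh < r' → r' < r → cell D r' c ≢ ghost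
    atR        : cell E r c ≡ ghost
    atRh       : cell E rh c ≡ ordinary
    elsewhere  : ∀ r' c' → ¬ (r' ≡ r × c' ≡ c) → ¬ (r' ≡ rh × c' ≡ c) →
                 cell E r' c' ≡ cell D r' c'

-- Reach D E : E is obtained from D by a finite sequence of ghost moves
-- (moves with G(D,r) = D are identities, so only effective moves are recorded).
data Reach : Diagram → Diagram → Set where
  done : ∀ {D E} → D ≈ E → Reach D E
  step : ∀ {D E F} (r : ℕ) → GhostStep D r E → Reach E F → Reach D F

_∈GKD_ : Diagram → Diagram → Set
E ∈GKD D = Reach D E

_⪯_ : Diagram → Diagram → Set
D₂ ⪯ D₁ = Reach D₁ D₂

IsJoinSemilattice : Diagram → Set
IsJoinSemilattice D =
  ∀ D₁ D₂ → D₁ ∈GKD D → D₂ ∈GKD D →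
  Σ Diagram λ U → U ∈GKD D × D₁ ⪯ U × D₂ ⪯ U ×
    (∀ V → V ∈GKD D → D₁ ⪯ V → D₂ ⪯ V → U ⪯ V)

{-# OPTIONS --safe #-}
-- Along ghost moves every position only evolves empty → ordinary → ghost, so a
-- cell can be blocked for good in two ways: by an occupied position to its
-- right, or by a ghost below it in its column with no gap in between.  If
-- X → X' moves the cell (s , c) to (h , c) and X' still reaches F, then no cell
-- of column c crosses row s on the way from X to F: the number of ordinary
-- cells above row s is a function of the diagram, and it cannot change once
-- (s , c) is a ghost.  Hence on any path from X to F the move of (s , c)
-- commutes to the front.  Restricted to the diagrams reaching both D₁ and D₂,
-- the moves are therefore locally confluent, and the join is the unique
-- terminal diagram reached from D by moves inside this restricted system.
module Submission where

open import Defs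
open import Data.Bool using (if_then_else_)
open import Data.Nat using (ℕ; zero; suc; _+_; _∸_; _≤_; _<_; _≟_; _≤?_; _<?_; s≤s; s≤s⁻¹)
open import Data.Nat.Properties
open import Data.Product using (Σ; ∃; _×_; _,_; proj₁; proj₂)
open import Data.Sum using (_⊎_; inj₁; inj₂)
open import Function using (_∘_)
open import Relation.Binary.Definitions using (tri<; tri≈; tri>)
open import Relation.Binary.PropositionalEquality
open import Relation.Nullary using (¬_; Dec; yes; no; does; contradiction)
open import Relation.Nullary.Decidable using (_×-dec_; _→-dec_; map′; dec-true; dec-false)

_≟ᶜ_ : (x y : Cell) → Dec (x ≡ y)
empty    ≟ᶜ empty    = yes refl
empty    ≟ᶜ ordinary = no λ ()
empty    ≟ᶜ ghost    = no λ ()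
ordinary ≟ᶜ empty    = no λ ()
ordinary ≟ᶜ ordinary = yes refl
ordinary ≟ᶜ ghost    = no λ ()
ghost    ≟ᶜ empty    = no λ ()
ghost    ≟ᶜ ordinary = no λ ()
ghost    ≟ᶜ ghost    = yes refl

clash : ∀ {x y z : Cell} → y ≢ z → x ≡ y → x ≢ z
clash y≢z x≡y x≡z = y≢z (trans (sym x≡y) x≡z)

position? : ∀ r′ c′ r c → Dec (r′ ≡ r × c′ ≡ c)
position? r′ c′ r c = (r′ ≟ r) ×-dec (c′ ≟ c)

-- GhostStep, split into its enabling condition and its effect.

record Movable (D : Diagram) (r c h : ℕ) : Set where
  field
    source  : cell D r c ≡ ordinary
    right   : ∀ c′ → c < c′ → cell D r c′ ≡ empty
    below   : h < r
    target  : cell D h c ≡ empty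
    between : ∀ r′ → h < r′ → r′ < r → cell D r′ c ≡ ordinary
open Movable

record Moves (D : Diagram) (r c h : ℕ) (E : Diagram) : Set where
  field
    source⁺ : cell E r c ≡ ghost
    target⁺ : cell E h c ≡ ordinary
    others  : ∀ r′ c′ → ¬ (r′ ≡ r × c′ ≡ c) → ¬ (r′ ≡ h × c′ ≡ c) →
              cell E r′ c′ ≡ cell D r′ c′
open Moves

record Step (D : Diagram) (r c h : ℕ) (E : Diagram) : Set where
  constructor _▹_
  field
    movable : Movable D r c h
    moves   : Moves D r c h E
open Step

fromGhostStep : ∀ {D r E} → GhostStep D r E → ∃ λ c → ∃ λ h → Step D r c h E
fromGhostStep {D} {r} g = c , rh , record
  { source = rightmost ; right = nothingRight ; below = rh<r ; target = rhEmpty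
  ; between = λ r′ h<r′ r′<r → ordinary-cell (rhMaximal r′ h<r′ r′<r) (noGhostBetween r′ h<r′ r′<r)
  } ▹ record { source⁺ = atR ; target⁺ = atRh ; others = elsewhere }
  where
  open GhostStep g
  ordinary-cell : ∀ {x} → x ≢ empty → x ≢ ghost → x ≡ ordinary
  ordinary-cell {empty}    x≢e _ = contradiction refl x≢e
  ordinary-cell {ordinary} _   _ = refl
  ordinary-cell {ghost}    _ x≢g = contradiction refl x≢g

toGhostStep : ∀ {D r c h E} → Step D r c h E → GhostStep D r E
toGhostStep {c = c} {h} (m ▹ u) = record
  { c = c ; rh = h
  ; rightmost = source m ; nothingRight = right m ; rh<r = below m ; rhEmpty = target m
  ; rhMaximal = λ r′ h<r′ r′<r → clash (λ ()) (between m r′ h<r′ r′<r)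
  ; noGhostBetween = λ r′ h<r′ r′<r → clash (λ ()) (between m r′ h<r′ r′<r)
  ; atR = source⁺ u ; atRh = target⁺ u ; elsewhere = others u
  }

Movable-transfer : ∀ {D E r c h} →
  (∀ r′ → h ≤ r′ → r′ ≤ r → cell E r′ c ≡ cell D r′ c) →
  (∀ c′ → c < c′ → cell E r c′ ≡ cell D r c′) →
  Movable D r c h → Movable E r c h
Movable-transfer {r = r} {c} {h} column row m = record
  { source  = trans (column r (<⇒≤ (below m)) ≤-refl) (source m)
  ; right   = λ c′ c<c′ → trans (row c′ c<c′) (right m c′ c<c′)
  ; below   = below m
  ; target  = trans (column h ≤-refl (<⇒≤ (below m))) (target m)
  ; between = λ r′ h<r′ r′<r → trans (column r′ (<⇒≤ h<r′) (<⇒≤ r′<r)) (between m r′ h<r′ r′<r)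
  }

Step-respˡ : ∀ {D D′ r c h E} → D ≈ D′ → Step D r c h E → Step D′ r c h E
Step-respˡ {r = r} {c} D≈D′ (m ▹ u) =
  Movable-transfer (λ r′ _ _ → sym (D≈D′ r′ c)) (λ c′ _ → sym (D≈D′ r c′)) m ▹
  record { source⁺ = source⁺ u ; target⁺ = target⁺ u
         ; others = λ r′ c′ ≢s ≢t → trans (others u r′ c′ ≢s ≢t) (D≈D′ r′ c′) }

-- The source is the rightmost cell of its row, and the target is the first gap below it, so the row
-- alone fixes the move.
Step-deterministic : ∀ {D r c h E c′ h′ E′} →
  Step D r c h E → Step D r c′ h′ E′ → E ≈ E′
Step-deterministic {D} {r} {c} {h} {E} {c′} {h′} {E′} (m ▹ u) (m′ ▹ u′) = same column≡ target≡
  where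
  column≡ : c ≡ c′
  column≡ with <-cmp c c′
  ... | tri< c<c′ _ _ = contradiction (right m c′ c<c′) (clash (λ ()) (source m′))
  ... | tri≈ _ eq _ = eq
  ... | tri> _ _ c′<c = contradiction (right m′ c c′<c) (clash (λ ()) (source m))
  target≡ : h ≡ h′
  target≡ with <-cmp h h′
  ... | tri< h<h′ _ _ = contradiction (subst (λ x → cell D h′ x ≡ empty) (sym column≡) (target m′))
                          (clash (λ ()) (between m h′ h<h′ (below m′)))
  ... | tri≈ _ eq _ = eq
  ... | tri> _ _ h′<h = contradiction (subst (λ x → cell D h x ≡ empty) column≡ (target m))
                          (clash (λ ()) (between m′ h h′<h (below m)))
  same : c ≡ c′ → h ≡ h′ → E ≈ E′
  same refl refl r₁ c₁ with position? r₁ c₁ r c | position? r₁ c₁ h c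
  ... | yes (refl , refl) | _ = trans (source⁺ u) (sym (source⁺ u′))
  ... | no _ | yes (refl , refl) = trans (target⁺ u) (sym (target⁺ u′))
  ... | no ≢s | no ≢t = trans (others u r₁ c₁ ≢s ≢t) (sym (others u′ r₁ c₁ ≢s ≢t))

perform : ∀ {D r c h} → Movable D r c h → Σ Diagram (Step D r c h)
perform {D} {r} {c} {h} m = E , m ▹ record
  { source⁺ = source-ghost ; target⁺ = target-ordinary ; others = unchanged }
  where
  after : ℕ → ℕ → Cell
  after r′ c′ =
    if does (position? r′ c′ r c) then ghost
    else if does (position? r′ c′ h c) then ordinary
    else cell D r′ c′
  source-ghost : after r c ≡ ghost
  source-ghost rewrite dec-true (position? r c r c) (refl , refl) = refl
  target-ordinary : after h c ≡ ordinary
  target-ordinary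
    rewrite dec-false (position? h c r c) (<⇒≢ (below m) ∘ proj₁)
          | dec-true (position? h c h c) (refl , refl) = refl
  unchanged : ∀ r′ c′ → ¬ (r′ ≡ r × c′ ≡ c) → ¬ (r′ ≡ h × c′ ≡ c) → after r′ c′ ≡ cell D r′ c′
  unchanged r′ c′ ≢s ≢t
    rewrite dec-false (position? r′ c′ r c) ≢s | dec-false (position? r′ c′ h c) ≢t = refl
  B = proj₁ (finite D)
  outside : ∀ {r′ c′} → (B ≤ r′ ⊎ B ≤ c′) → cell D r′ c′ ≡ empty
  outside = proj₂ (finite D) _ _
  -- A cell falls within its own column, so the box of `D` still encloses the result.
  outside-row : (B ≤ h ⊎ B ≤ c) → (B ≤ r ⊎ B ≤ c)
  outside-row (inj₁ B≤h) = inj₁ (≤-trans B≤h (<⇒≤ (below m)))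
  outside-row (inj₂ B≤c) = inj₂ B≤c
  after-outside : ∀ r′ c′ → (B ≤ r′ ⊎ B ≤ c′) → after r′ c′ ≡ empty
  after-outside r′ c′ out = trans
    (unchanged r′ c′
      (λ { (refl , refl) → clash (λ ()) (source m) (outside out) })
      (λ { (refl , refl) → clash (λ ()) (source m) (outside (outside-row out)) }))
    (outside out)
  E : Diagram
  E = record { cell = after ; finite = B , after-outside }

-- Monotonicity of cell contents under one move.

module _ {D r c h E} (st : Step D r c h E) where
  private
    m = movable st
    u = moves st

  step-occupied : ∀ r′ c′ → cell D r′ c′ ≢ empty → cell E r′ c′ ≢ empty
  step-occupied r′ c′ occ with position? r′ c′ r c | position? r′ c′ h c
  ... | yes (refl , refl) | _ = clash (λ ()) (source⁺ u)
  ... | no _ | yes (refl , refl) = contradiction (target m) occ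
  ... | no ≢s | no ≢t = occ ∘ trans (sym (others u r′ c′ ≢s ≢t))

  step-ghost : ∀ r′ c′ → cell D r′ c′ ≡ ghost → cell E r′ c′ ≡ ghost
  step-ghost r′ c′ gh with position? r′ c′ r c | position? r′ c′ h c
  ... | yes (refl , refl) | _ = source⁺ u
  ... | no _ | yes (refl , refl) = contradiction gh (clash (λ ()) (target m))
  ... | no ≢s | no ≢t = trans (others u r′ c′ ≢s ≢t) gh

  step-non-ghost : ∀ r′ c′ → cell D r′ c′ ≢ ghost → ¬ (r′ ≡ r × c′ ≡ c) → cell E r′ c′ ≢ ghost
  step-non-ghost r′ c′ ng ≢s with position? r′ c′ h c
  ... | yes (refl , refl) = clash (λ ()) (target⁺ u)
  ... | no ≢t = ng ∘ trans (sym (others u r′ c′ ≢s ≢t))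

-- Paths and permanently blocked cells.

length : ∀ {D E} → Reach D E → ℕ
length (done _) = 0
length (step _ _ p) = suc (length p)

-- Diagrams are compared only cell by cell, so paths are transported by hand. The length is tracked
-- because it bounds the recursion in `join`.
Reach-respˡ : ∀ {D D′ E} → D ≈ D′ → (p : Reach D E) → Σ (Reach D′ E) λ q → length q ≡ length p
Reach-respˡ D≈D′ (done D≈E) = done (λ r c → trans (sym (D≈D′ r c)) (D≈E r c)) , refl
Reach-respˡ D≈D′ (step r g p) =
  step r (toGhostStep (Step-respˡ D≈D′ (proj₂ (proj₂ (fromGhostStep g))))) p , refl

Reach-trans : ∀ {D E F} → Reach D E → Reach E F → Reach D F
Reach-trans (done D≈E) q = proj₁ (Reach-respˡ (λ r c → sym (D≈E r c)) q)
Reach-trans (step r g p) q = step r g (Reach-trans p q)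

reach-ghost : ∀ {D E} → Reach D E → ∀ r c → cell D r c ≡ ghost → cell E r c ≡ ghost
reach-ghost (done D≈E) r c gh = trans (sym (D≈E r c)) gh
reach-ghost (step _ g p) r c gh =
  reach-ghost p r c (step-ghost (proj₂ (proj₂ (fromGhostStep g))) r c gh)

-- Only the rightmost cell of a row can turn into a ghost, and the occupied position at `c′` never
-- empties again.
blocked-by-right : ∀ {D E} → Reach D E → ∀ {r c c′} → c < c′ →
  cell D r c′ ≢ empty → cell D r c ≢ ghost → cell E r c ≢ ghost
blocked-by-right (done D≈E) {r} {c} _ _ ng = ng ∘ trans (D≈E r c)
blocked-by-right (step t g p) {r} {c} {c′} c<c′ occ ng with fromGhostStep g
... | d , k , st = blocked-by-right p c<c′ (step-occupied st r c′ occ)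
  (step-non-ghost st r c ng λ { (refl , refl) → occ (right (movable st) c′ c<c′) })

-- A move of `(r , c)` would have to land above the ghost, where no position is empty, on it, or
-- below it, passing over a ghost. All hypotheses persist along the path.
blocked-by-ghost : ∀ {D E} → Reach D E → ∀ {r g c} → g < r →
  cell D g c ≡ ghost → (∀ r′ → g < r′ → r′ < r → cell D r′ c ≢ empty) →
  cell D r c ≢ ghost → cell E r c ≢ ghost
blocked-by-ghost (done D≈E) {r} {c = c} _ _ _ ng = ng ∘ trans (D≈E r c)
blocked-by-ghost (step t gs p) {r} {g} {c} g<r gh occ ng with fromGhostStep gs
... | d , k , st = blocked-by-ghost p g<r (step-ghost st g c gh)
  (λ r′ g<r′ r′<r → step-occupied st r′ c (occ r′ g<r′ r′<r))
  (step-non-ghost st r c ng λ { (refl , refl) → immovable (movable st) })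
  where
  immovable : ∀ {k} → ¬ Movable _ r c k
  immovable {k} m with <-cmp k g
  ... | tri< k<g _ _ = clash (λ ()) gh (between m g k<g g<r)
  ... | tri≈ _ refl _ = clash (λ ()) gh (target m)
  ... | tri> _ _ g<k = occ k g<k (below m) (target m)

-- Counting ordinary cells

weight : Cell → ℕ
weight empty    = 0
weight ordinary = 1
weight ghost    = 0

count : (ℕ → Cell) → ℕ → ℕ
count f zero    = 0
count f (suc n) = weight (f n) + count f n

weight-other : ∀ {x} → x ≢ ordinary → weight x ≡ 0
weight-other {empty}    _ = refl
weight-other {ordinary} x≢o = contradiction refl x≢o
weight-other {ghost}    _ = refl

count-cong : ∀ {f g} n → (∀ i → i < n → f i ≡ g i) → count f n ≡ count g n
count-cong zero eq = refl
count-cong (suc n) eq =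
  cong₂ _+_ (cong weight (eq n ≤-refl)) (count-cong n λ i i<n → eq i (m<n⇒m<1+n i<n))

count-remove : ∀ {f g i} n → i < n → f i ≡ ordinary → g i ≢ ordinary →
  (∀ j → j ≢ i → f j ≡ g j) → count f n ≡ suc (count g n)
count-remove {f} {g} {i} (suc n) i<1+n fi gi eq with i ≟ n
... | yes refl rewrite fi | weight-other gi =
  cong suc (count-cong n λ j j<n → eq j (<⇒≢ j<n))
... | no i≢n rewrite eq n (i≢n ∘ sym) = trans
  (cong (weight (g n) +_) (count-remove n (≤∧≢⇒< (s≤s⁻¹ i<1+n) i≢n) fi gi eq))
  (+-suc (weight (g n)) (count g n))

-- Both counts exceed by one that of `mid`, which is `g` with its value at `j` reset to that of `f`.
count-exchange : ∀ {f g i j} n → i < n → j < n → i ≢ j →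
  f i ≡ ordinary → g i ≢ ordinary → f j ≢ ordinary → g j ≡ ordinary →
  (∀ k → k ≢ i → k ≢ j → f k ≡ g k) → count f n ≡ count g n
count-exchange {f} {g} {i} {j} n i<n j<n i≢j fi gi fj gj eq = trans
  (count-remove n i<n fi (gi ∘ trans (sym (at-others i i≢j))) f-mid)
  (sym (count-remove n j<n gj (fj ∘ trans (sym at-j)) λ k k≢j → sym (at-others k k≢j)))
  where
  mid : ℕ → Cell
  mid k = if does (k ≟ j) then f j else g k
  at-j : mid j ≡ f j
  at-j rewrite dec-true (j ≟ j) refl = refl
  at-others : ∀ k → k ≢ j → mid k ≡ g k
  at-others k k≢j rewrite dec-false (k ≟ j) k≢j = refl
  f-mid : ∀ k → k ≢ i → f k ≡ mid k
  f-mid k k≢i with k ≟ j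
  ... | yes refl = sym at-j
  ... | no k≢j = trans (eq k k≢i k≢j) (sym (at-others k k≢j))

-- One row bound shared by a whole path, since the bounds stored in `finite` may vary from diagram
-- to diagram while counts are compared over a single window.
Bounded : ℕ → Diagram → Set
Bounded K D = ∀ r c → K ≤ r → cell D r c ≡ empty

step-bounded : ∀ {K D r c h E} → Step D r c h E → Bounded K D → Bounded K E
step-bounded {r = r} {c} (m ▹ u) bd r′ c′ K≤r′ = trans
  (others u r′ c′
    (λ { (refl , refl) → clash (λ ()) (source m) (bd r c K≤r′) })
    (λ { (refl , refl) → clash (λ ()) (source m) (bd r c (≤-trans K≤r′ (<⇒≤ (below m)))) }))
  (bd r′ c′ K≤r′)

-- On K-bounded diagrams this counts all ordinary cells of column c above row s.
above : ℕ → ℕ → ℕ → Diagram → ℕ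
above K s c D = count (λ i → cell D (suc s + i) c) K

module _ {K D r c h E} (bd : Bounded K D) (st : Step D r c h E) where
  private
    m = movable st
    u = moves st

    r<K : r < K
    r<K = ≰⇒> λ K≤r → clash (λ ()) (source m) (bd r c K≤r)

    row-offset : ∀ {s t} → s < t → suc s + (t ∸ suc s) ≡ t
    row-offset = m+[n∸m]≡n

    offset-unique : ∀ {s t j} → s < t → suc s + j ≡ t → j ≡ t ∸ suc s
    offset-unique {s} s<t eq = +-cancelˡ-≡ (suc s) _ _ (trans eq (sym (row-offset s<t)))

    offset< : ∀ {s t} → t < K → t ∸ suc s < K
    offset< {s} {t} = ≤-<-trans (m∸n≤m t (suc s))

  above-cross : ∀ {s} → s < r → h ≤ s → above K s c D ≡ suc (above K s c E)
  above-cross {s} s<r h≤s = count-remove K (offset< {s} r<K)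
    (trans (cong (λ x → cell D x c) (row-offset s<r)) (source m))
    (clash (λ ()) (trans (cong (λ x → cell E x c) (row-offset s<r)) (source⁺ u)))
    λ j j≢ → sym (others u (suc s + j) c
      (j≢ ∘ offset-unique s<r ∘ proj₁)
      (<⇒≢ (≤-<-trans h≤s (s≤s (m≤m+n s j))) ∘ sym ∘ proj₁))

  -- Either the move happens in another column, or it stays at or below row `s`, or it stays above
  -- row `s`, where one ordinary cell is lost and one gained.
  above-uncrossed : ∀ {s d} → ¬ (d ≡ c × s < r × h ≤ s) → above K s d D ≡ above K s d E
  above-uncrossed {s} {d} ¬cross with d ≟ c | s <? r
  ... | no d≢c | _ = count-cong K λ j _ →
    sym (others u (suc s + j) d (d≢c ∘ proj₂) (d≢c ∘ proj₂))
  ... | yes refl | no s≮r = count-cong K λ j _ → sym (others u (suc s + j) d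
    (λ { (eq , _) → s≮r (subst (s <_) eq (s≤s (m≤m+n s j))) })
    (λ { (eq , _) → s≮r (<-trans (subst (s <_) eq (s≤s (m≤m+n s j))) (below m)) }))
  ... | yes refl | yes s<r = count-exchange K
    (offset< {s} r<K) (offset< {s} (<-trans (below m) r<K))
    (λ eq → <⇒≢ (below m) (trans (sym (row-offset s<h)) (trans (cong (suc s +_) (sym eq)) (row-offset s<r))))
    (trans (cong (λ x → cell D x c) (row-offset s<r)) (source m))
    (clash (λ ()) (trans (cong (λ x → cell E x c) (row-offset s<r)) (source⁺ u)))
    (clash (λ ()) (trans (cong (λ x → cell D x c) (row-offset s<h)) (target m)))
    (trans (cong (λ x → cell E x c) (row-offset s<h)) (target⁺ u))
    λ j j≢r j≢h → sym (others u (suc s + j) c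
      (j≢r ∘ offset-unique s<r ∘ proj₁) (j≢h ∘ offset-unique s<h ∘ proj₁))
    where
    s<h : s < h
    s<h = ≰⇒> λ h≤s → ¬cross (refl , s<r , h≤s)

  above-antitone : ∀ s d → above K s d E ≤ above K s d D
  above-antitone s d with (d ≟ c) ×-dec ((s <? r) ×-dec (h ≤? s))
  ... | yes (refl , s<r , h≤s) = ≤-trans (n≤1+n _) (≤-reflexive (sym (above-cross s<r h≤s)))
  ... | no ¬cross = ≤-reflexive (sym (above-uncrossed ¬cross))

reach-above : ∀ {K D E} → Bounded K D → Reach D E → ∀ s c → above K s c E ≤ above K s c D
reach-above {K} bd (done D≈E) s c =
  ≤-reflexive (count-cong K λ i _ → sym (D≈E (suc s + i) c))
reach-above bd (step _ g p) s c with fromGhostStep g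
... | _ , _ , st = ≤-trans (reach-above (step-bounded st bd) p s c) (above-antitone bd st s c)

-- A move crossing row `s` in this column finds `(s , c)` empty or ordinary, never a ghost. With
-- `reach-above`, the count is frozen.
reach-above-ghost : ∀ {K D E} → Bounded K D → Reach D E → ∀ {s c} → cell D s c ≡ ghost →
  above K s c D ≤ above K s c E
reach-above-ghost {K} bd (done D≈E) {s} {c} _ =
  ≤-reflexive (count-cong K λ i _ → D≈E (suc s + i) c)
reach-above-ghost {K} {D} bd (step r g p) {s} {c} gh with fromGhostStep g
... | d , h , st = ≤-trans (≤-reflexive (above-uncrossed bd st uncrossed))
  (reach-above-ghost (step-bounded st bd) p (step-ghost st s c gh))
  where
  uncrossed : ¬ (c ≡ d × s < r × h ≤ s)
  uncrossed (refl , s<r , h≤s) with h ≟ s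
  ... | yes refl = clash (λ ()) gh (target (movable st))
  ... | no h≢s = clash (λ ()) gh (between (movable st) s (≤∧≢⇒< h≤s h≢s) s<r)

-- Safe moves.

-- A diagram X reaching F still reaches F after moving (s , c) to (h , c)
-- exactly if this holds.
record Safe (K : ℕ) (X : Diagram) (s c h : ℕ) (F : Diagram) : Set where
  field
    eventual  : cell F s c ≡ ghost
    uncrossed : above K s c X ≤ above K s c F
    exposed   : ∀ c′ → c′ < c → cell F h c′ ≡ ghost → cell X h c′ ≡ ghost
open Safe

-- The move starts in row `s` itself, so it leaves the count above unchanged, and the new ghost then
-- freezes it. For `exposed`, the cell landing at `(h , c)` blocks everything to its left in row
-- `h`, so ghosts found there in `F` were present already in `X`.
reach⇒safe : ∀ {K X s c h X′ F} → Bounded K X → Step X s c h X′ → Reach X′ F → Safe K X s c h F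
reach⇒safe {K} {X} {s} {c} {h} {X′} bd st p = record
  { eventual  = reach-ghost p s c (source⁺ (moves st))
  ; uncrossed = ≤-trans (≤-reflexive (above-uncrossed bd st λ { (_ , s<s , _) → <-irrefl refl s<s }))
                  (reach-above-ghost (step-bounded st bd) p (source⁺ (moves st)))
  ; exposed   = exposed′
  }
  where
  exposed′ : ∀ c′ → c′ < c → _ → cell X h c′ ≡ ghost
  exposed′ c′ c′<c gh with cell X h c′ ≟ᶜ ghost
  ... | yes eq = eq
  ... | no ng = contradiction gh (blocked-by-right p c′<c
    (clash (λ ()) (target⁺ (moves st)))
    (step-non-ghost st h c′ ng λ { (_ , c′≡c) → <⇒≢ c′<c c′≡c }))

Safe-step : ∀ {K X s c h F t d k W} → Bounded K X → Step X t d k W →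
  Safe K X s c h F → Safe K W s c h F
Safe-step {s = s} {c} {h} bd st safe = record
  { eventual  = eventual safe
  ; uncrossed = ≤-trans (above-antitone bd st s c) (uncrossed safe)
  ; exposed   = λ c′ c′<c gh → step-ghost st h c′ (exposed safe c′ c′<c gh)
  }

-- Commutation of moves and confluence.

module _ {X s c h X′ t d k W}
  (st : Step X s c h X′) (st′ : Step X t d k W)
  (mW : Movable W s c h) (mX′ : Movable X′ t d k) (t≢s : t ≢ s) where

  commute : Σ Diagram λ Y → Step W s c h Y × Step X′ t d k Y
  commute with perform mW
  ... | Y , (_ ▹ v) = Y , mW ▹ v , mX′ ▹ record
    { source⁺ = trans (others v t d (t≢s ∘ proj₁)
                  λ { (refl , refl) → clash (λ ()) (target (movable st)) (source (movable st′)) })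
                  (source⁺ u′)
    ; target⁺ = trans (others v k d
                  (λ { (refl , refl) → clash (λ ()) (target (movable st′)) (source (movable st)) })
                  -- The targets differ: the first move fills `(h , c)`, while `mX′` needs its own
                  -- target empty in `X′`.
                  (λ { (refl , refl) → clash (λ ()) (target mX′) (target⁺ u) }))
                  (target⁺ u′)
    ; others  = unchanged
    }
    where
    u = moves st
    u′ = moves st′
    unchanged : ∀ r e → ¬ (r ≡ t × e ≡ d) → ¬ (r ≡ k × e ≡ d) → cell Y r e ≡ cell X′ r e
    unchanged r e ≢t ≢k with position? r e s c | position? r e h c
    ... | yes (refl , refl) | _ = trans (source⁺ v) (sym (source⁺ u))
    ... | no _ | yes (refl , refl) = trans (target⁺ v) (sym (target⁺ u))
    ... | no ≢s | no ≢h = trans (others v r e ≢s ≢h)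
      (trans (others u′ r e ≢t ≢k) (sym (others u r e ≢s ≢h)))

module _ {K X s c h X′ t d k W F} (bd : Bounded K X)
  (st : Step X s c h X′) (st′ : Step X t d k W)
  (p : Reach W F) (safe : Safe K X s c h F) (t≢s : t ≢ s) where
  private
    m = movable st
    m′ = movable st′

    not-yet-ghost : cell W s c ≢ ghost
    not-yet-ghost = step-non-ghost st′ s c (clash (λ ()) (source m)) (t≢s ∘ sym ∘ proj₁)

    -- Within one column the two moves span disjoint rows. If `t` is above `s`, a landing below `s`
    -- would lower the count that `uncrossed` protects. If `t` is below `s` but above `h`, its ghost
    -- would block `(s , c)`, against `eventual`.
    separated : c ≡ d → s < k ⊎ t < h
    separated refl with <-cmp s t | <-cmp s k | <-cmp t h
    ... | tri< _ _ _ | tri< s<k _ _ | _ = inj₁ s<k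
    ... | tri< _ _ _ | tri≈ _ refl _ | _ = contradiction (target m′) (clash (λ ()) (source m))
    ... | tri< s<t _ _ | tri> _ _ k<s | _ = contradiction
      (≤-trans (uncrossed safe) (reach-above (step-bounded st′ bd) p s c))
      (<⇒≱ (≤-reflexive (sym (above-cross bd st′ s<t (<⇒≤ k<s)))))
    ... | tri≈ _ s≡t _ | _ | _ = contradiction (sym s≡t) t≢s
    ... | tri> _ _ _ | _ | tri< t<h _ _ = inj₂ t<h
    ... | tri> _ _ _ | _ | tri≈ _ refl _ = contradiction (target m) (clash (λ ()) (source m′))
    ... | tri> _ _ t<s | _ | tri> _ _ h<t = contradiction (eventual safe)
      (blocked-by-ghost p t<s (source⁺ (moves st′))
        (λ r t<r r<s → step-occupied st′ r c (clash (λ ()) (between m r (<-trans h<t t<r) r<s)))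
        not-yet-ghost)

    outside : ∀ {r a b} → c ≡ d → h ≤ a → a ≤ s → k ≤ b → b ≤ t → r ≡ a → r ≢ b
    outside c≡d h≤a a≤s k≤b b≤t refl refl with separated c≡d
    ... | inj₁ s<k = <⇒≱ s<k (≤-trans k≤b a≤s)
    ... | inj₂ t<h = <⇒≱ t<h (≤-trans h≤a b≤t)

    h≤s : h ≤ s
    h≤s = <⇒≤ (below m)

    k≤t : k ≤ t
    k≤t = <⇒≤ (below m′)

    movable-after : Movable W s c h
    movable-after = Movable-transfer
      (λ r h≤r r≤s → others (moves st′) r c
        (λ { (r≡t , c≡d) → outside c≡d h≤r r≤s k≤t ≤-refl refl r≡t })
        (λ { (r≡k , c≡d) → outside c≡d h≤r r≤s ≤-refl k≤t refl r≡k }))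
      (λ c′ c<c′ → others (moves st′) s c′ (t≢s ∘ sym ∘ proj₁)
        -- A cell landing in row `s` to the right of `c` would keep `(s , c)` from ever becoming a
        -- ghost.
        λ { (refl , refl) → blocked-by-right p c<c′
              (clash (λ ()) (target⁺ (moves st′))) not-yet-ghost (eventual safe) })
      m

    movable-before : Movable X′ t d k
    movable-before = Movable-transfer
      (λ r k≤r r≤t → others (moves st) r d
        (λ { (r≡s , d≡c) → outside (sym d≡c) h≤s ≤-refl k≤r r≤t r≡s refl })
        (λ { (r≡h , d≡c) → outside (sym d≡c) ≤-refl h≤s k≤r r≤t r≡h refl }))
      (λ c′ d<c′ → others (moves st) t c′ (t≢s ∘ proj₁)
        -- Here the safe move would land in row `t` to the right of `d`. Since `(t , d)` is a ghost
        -- in `F`, `exposed` would make it one already in `X`, where it is ordinary.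
        λ { (refl , refl) → clash (λ ()) (source m′)
              (exposed safe d d<c′ (reach-ghost p t d (source⁺ (moves st′)))) })
      m′

  diamond : Σ Diagram λ Y → Step W s c h Y × Step X′ t d k Y
  diamond = commute st st′ movable-after movable-before t≢s

-- By `eventual` the path must move `(s , c)` at some point. Until then `diamond` carries the safe
-- move past each step; at row `s` determinism identifies the two moves, and one step of the path is
-- saved.
safe⇒reach : ∀ {K X s c h X′ F} → Bounded K X → Step X s c h X′ → Safe K X s c h F →
  (p : Reach X F) → Σ (Reach X′ F) λ q → suc (length q) ≡ length p
safe⇒reach {s = s} {c} _ st safe (done X≈F) =
  contradiction (trans (X≈F s c) (eventual safe)) (clash (λ ()) (source (movable st)))
safe⇒reach {s = s} bd st safe (step t g p) with fromGhostStep g | t ≟ s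
... | _ , _ , st′ | yes refl with Reach-respˡ (Step-deterministic st′ st) p
...   | q , eq = q , cong suc eq
safe⇒reach {s = s} bd st safe (step t g p) | _ , _ , st′ | no t≢s
  with diamond bd st st′ p safe t≢s
... | _ , stW , stX′ with safe⇒reach (step-bounded st′ bd) stW (Safe-step bd st′ safe) p
...   | q , eq = step t (toGhostStep stX′) q , cong suc eq

-- If the path to `V` contains a move at row `s`, then `Y` is `V`; otherwise the move of `(s , c)`
-- commutes past the whole path and `Y` is `V` after that move.
confluent : ∀ {K X s c h X′ V F₁ F₂} → Bounded K X → Step X s c h X′ →
  Reach X′ F₁ → Reach X′ F₂ → Reach X V → Reach V F₁ → Reach V F₂ →
  Σ Diagram λ Y → Reach X′ Y × Reach V Y × Reach Y F₁ × Reach Y F₂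
confluent {s = s} {X′ = X′} bd st p₁ p₂ (done X≈V) _ _ =
  X′ , done (λ _ _ → refl) , step s (toGhostStep (Step-respˡ X≈V st)) (done λ _ _ → refl) , p₁ , p₂
confluent {s = s} {V = V} bd st p₁ p₂ (step t g q) q₁ q₂ with fromGhostStep g | t ≟ s
... | _ , _ , st′ | yes refl =
  V , proj₁ (Reach-respˡ (Step-deterministic st′ st) q) , done (λ _ _ → refl) , q₁ , q₂
... | _ , _ , st′ | no t≢s
  with reach⇒safe bd st p₁ | reach⇒safe bd st p₂ | step-bounded st′ bd
... | safe₁ | safe₂ | bdW with diamond bd st st′ (Reach-trans q q₁) safe₁ t≢s
... | _ , stW , stX′ with confluent bdW stW
        -- Safety survives the step to `W`, so both `F₁` and `F₂` remain reachable after the move is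
        -- made there.
        (proj₁ (safe⇒reach bdW stW (Safe-step bd st′ safe₁) (Reach-trans q q₁)))
        (proj₁ (safe⇒reach bdW stW (Safe-step bd st′ safe₂) (Reach-trans q q₂)))
        q q₁ q₂
... | Y , W′→Y , V→Y , Y→F₁ , Y→F₂ =
  Y , step t (toGhostStep stX′) W′→Y , V→Y , Y→F₁ , Y→F₂

-- Decidability

movable? : ∀ X r c h → Dec (Movable X r c h)
movable? X r c h = map′
  (λ (a , b , e , f , g) → record
    { source = a ; below = b ; target = e
    ; right = λ c′ c<c′ → right′ f c′ c<c′
    ; between = λ r′ h<r′ r′<r → g r′<r h<r′ })
  (λ m → source m , below m , target m , (λ {c′} _ → right m c′) , λ {r′} r′<r h<r′ → between m r′ h<r′ r′<r)
  ((cell X r c ≟ᶜ ordinary) ×-dec (h <? r) ×-dec (cell X h c ≟ᶜ empty) ×-dec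
   allUpTo? (λ c′ → (c <? c′) →-dec (cell X r c′ ≟ᶜ empty)) B ×-dec
   allUpTo? (λ r′ → (h <? r′) →-dec (cell X r′ c ≟ᶜ ordinary)) r)
  where
  B = proj₁ (finite X)
  right′ : (∀ {c′} → c′ < B → c < c′ → cell X r c′ ≡ empty) → ∀ c′ → c < c′ → cell X r c′ ≡ empty
  right′ f c′ c<c′ with c′ <? B
  ... | yes c′<B = f c′<B c<c′
  ... | no c′≮B = proj₂ (finite X) r c′ (inj₂ (≮⇒≥ c′≮B))

safe? : ∀ K X s c h F → Dec (Safe K X s c h F)
safe? K X s c h F = map′
  (λ (a , b , e) → record { eventual = a ; uncrossed = b ; exposed = λ c′ c′<c → e c′<c })
  (λ safe → eventual safe , uncrossed safe , λ {c′} → exposed safe c′)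
  ((cell F s c ≟ᶜ ghost) ×-dec (above K s c X ≤? above K s c F) ×-dec
   allUpTo? (λ c′ → (cell F h c′ ≟ᶜ ghost) →-dec (cell X h c′ ≟ᶜ ghost)) c)

-- A move of the restricted system at `X`. Stating reachability of `F₁` and `F₂` through `Safe`
-- turns the search for such a move into a finite check of cells, with no search over paths.
CommonMove : ℕ → Diagram → Diagram → Diagram → ℕ → ℕ → ℕ → Set
CommonMove K X F₁ F₂ s c h = Movable X s c h × Safe K X s c h F₁ × Safe K X s c h F₂

commonMove? : ∀ K X F₁ F₂ → Dec (∃ λ s → ∃ λ c → ∃ λ h → CommonMove K X F₁ F₂ s c h)
commonMove? K X F₁ F₂ = map′
  (λ (s , _ , c , _ , h , _ , good) → s , c , h , good)
  (λ (s , c , h , good@(m , _)) →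
    s , inside m (λ B≤s → inj₁ B≤s) , c , inside m (λ B≤c → inj₂ B≤c) , h , below m , good)
  (anyUpTo? (λ s → anyUpTo? (λ c → anyUpTo? (λ h →
     movable? X s c h ×-dec safe? K X s c h F₁ ×-dec safe? K X s c h F₂) s) B) B)
  where
  B = proj₁ (finite X)
  inside : ∀ {s c h i} → Movable X s c h → (B ≤ i → B ≤ s ⊎ B ≤ c) → i < B
  inside {s} {c} m out = ≰⇒> λ B≤i →
    clash (λ ()) (source m) (proj₂ (finite X) s c (out B≤i))

-- Construction of the join.

Join : Diagram → Diagram → Diagram → Set
Join X F₁ F₂ = Σ Diagram λ U → U ∈GKD X × F₁ ⪯ U × F₂ ⪯ U ×
  (∀ V → V ∈GKD X → F₁ ⪯ V → F₂ ⪯ V → U ⪯ V)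

-- Common moves are made as long as one exists. Each shortens the path to `F₁` by one, so `n` serves
-- as fuel.
join : ∀ {K X F₁ F₂} n → Bounded K X → (p : Reach X F₁) → length p ≤ n → Reach X F₂ → Join X F₁ F₂
join {K} {X} {F₁} {F₂} n bd p p≤n q with commonMove? K X F₁ F₂
-- The first step towards any other upper bound below `X` would be a common move, so `X` is the only
-- candidate.
... | no ¬common = X , done (λ _ _ → refl) , p , q , least
  where
  least : ∀ V → Reach X V → Reach V F₁ → Reach V F₂ → Reach V X
  least V (done X≈V) _ _ = done λ r′ c′ → sym (X≈V r′ c′)
  least V (step s g r) r₁ r₂ with fromGhostStep g
  ... | c , h , st = contradiction
    (s , c , h , movable st
       , reach⇒safe bd st (Reach-trans r r₁) , reach⇒safe bd st (Reach-trans r r₂))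
    ¬common
... | yes (s , c , h , m , safe₁ , safe₂) with perform m
... | X′ , st with safe⇒reach bd st safe₁ p | safe⇒reach bd st safe₂ q
... | p′ , eq | q′ , _ with n | ≤-trans (≤-reflexive eq) p≤n
... | suc n′ | s≤s p′≤n′ with join n′ (step-bounded st bd) p′ p′≤n′ q′
... | U , X′→U , U→F₁ , U→F₂ , least = U , step s (toGhostStep st) X′→U , U→F₁ , U→F₂ , least′
  where
  least′ : ∀ V → Reach X V → Reach V F₁ → Reach V F₂ → Reach V U
  least′ V r r₁ r₂ with confluent bd st p′ q′ r r₁ r₂
  -- `Y` is an upper bound below both `V` and `X′`, so minimality of `U` under `X′` puts `U` below
  -- `Y` and hence below `V`.
  ... | Y , X′→Y , V→Y , Y→F₁ , Y→F₂ = Reach-trans V→Y (least Y X′→Y Y→F₁ Y→F₂)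

theorem3p9 : (D : Diagram) → NoGhosts D → IsJoinSemilattice D
theorem3p9 D _ D₁ D₂ p q =
  join (length p) (λ r c B≤r → proj₂ (finite D) r c (inj₁ B≤r)) p ≤-refl q
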